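{- Let $n\ge 1$. For all integers $i,j$ with $1\leq i\leq n$ and $\frac12\log i\leq j\leq 2\log i$, define $$\alpha_1(i,j)=\max_{0\leq t\leq i/2}\{a(t,j-1,1)+a(i-t-1,j-1,1)\},$$ $$\alpha_2(i,j)=\max_{0\leq t\leq i/2}\{a(t,j,0)+a(i-t-1,j,0)\},$$ $$\alpha_3(i,j)=\max_{0\leq t\leq i/2}\{a(t,j-1,1)+a(i-t-1,j,0)\},$$ where $t$ ranges over integers. Then for all such $i,j$, $$a(i,j,0)=1+\alpha_1(i,j),\qquad a(i,j,1)=\max\{\alpha_1(i,j),\alpha_2(i,j),\alpha_3(i,j)\}.$$
   Context: Here $\log$ denotes the base-2 logarithm. A (relaxed) red-black tree on $n$ keys is a binary search tree with $n$ internal nodes (the nodes holding keys), in which every missing child is regarded as a leaf (NIL), together with a coloring of its nodes such that: each node is either red or black; all leaves (NIL) are black; every red node has two black children (NIL leaves count as black); and, for every node, every path from that node to a descendant leaf contains the same number of black nodes. The root may be red or black. For $n=0$ the tree is a single black NIL leaf. The black-height of a node $x$ is the number of black nodes on any simple path from, but not including, $x$ down to a leaf (the black NIL leaf at the end of the path is counted, so a NIL leaf has black-height $0$). The black-height of a tree is the black-height of its root. For integers $i\ge 0$ and $j$, $a(i,j,0)$ (respectively $a(i,j,1)$) denotes the largest number of red internal nodes in a red-black tree on $i$ keys of black-height $j$ whose root is red (respectively black). If no such tree exists the value is $-\infty$ (with $-\infty+x=-\infty$). In particular $a(0,0,1)=0$, $a(0,j,1)=-\infty$ for $j\neq 0$,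 and $a(0,j,0)=-\infty$ for all $j$. -}

module Defs where

open import Data.Integer as ℤ using (ℤ; +_; -[1+_]; 1ℤ)
import Data.Integer.Properties as ℤ using (_≟_)
open import Data.List.Base using (List; []; _∷_; _++_; map; foldr; filter; upTo; cartesianProductWith; cartesianProduct)
open import Data.List.Membership.Propositional using (_∈_)
open import Data.List.Membership.Propositional.Properties
  using (∈-filter⁺; ∈-filter⁻; ∈-upTo⁺; ∈-cartesianProductWith⁺; ∈-cartesianProduct⁺)
open import Data.List.Relation.Unary.All as All using (All; []; _∷_; all?)
import Data.List.Relation.Unary.All.Properties as All
open import Data.List.Relation.Unary.Any using (here; there)
open import Data.Nat using (ℕ; zero; suc; _+_; _*_; _∸_; _^_; _⊔_; _≤_; _<_; z≤n; s≤s; ⌊_/2⌋; _≟_; _<?_)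
open import Data.Nat.Properties
  using (≤-trans; <-≤-trans; ≤-reflexive; ≤-totalOrder; <⇒≤; m≤m+n; m≤n+m; n<1+n; +-suc; +-assoc; +-monoʳ-<; +-monoʳ-≤)
open import Data.List.Extrema ≤-totalOrder using (argmax; argmax-all; f[⊥]≤f[argmax]; f[xs]≤f[argmax])
open import Data.Product using (_×_; _,_; proj₁; proj₂; ∃)
open import Data.Unit using (⊤; tt)
open import Function using (case_of_)
open import Relation.Binary.PropositionalEquality
  using (_≡_; refl; sym; trans; cong; cong₂; subst)
open import Relation.Nullary using (¬_; Dec; yes; no)
open import Relation.Nullary.Construct.Add.Infimum using (_₋; ⊥₋; [_])
open import Relation.Nullary.Decidable using (map′; _×-dec_)

data Colour : Set where
  red black : Colour

-- Only internal nodes carry a key and a colour; `nil` is a NIL leaf.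
data Tree : Set where
  nil  : Tree
  node : Colour → Tree → ℕ → Tree → Tree

colour : Tree → Colour
colour nil            = black
colour (node c _ _ _) = c

size : Tree → ℕ
size nil            = 0
size (node _ l _ r) = suc (size l + size r)

keys : Tree → List ℕ
keys nil            = []
keys (node _ l k r) = keys l ++ k ∷ keys r

redCount : Tree → ℕ
redCount nil                = 0
redCount (node red   l _ r) = suc (redCount l + redCount r)
redCount (node black l _ r) = redCount l + redCount r

isBlack : Colour → ℕ
isBlack red   = 0
isBlack black = 1

-- One entry for each path from the root to a NIL leaf: the number of black
-- nodes on that path, the root excluded and the NIL leaf included.
blackCounts : Tree → List ℕ
blackCounts nil            = 0 ∷ []
blackCounts (node _ l _ r) =
  map (λ b → isBlack (colour l) + b) (blackCounts l) ++
  map (λ b → isBlack (colour r) + b) (blackCounts r)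

data EveryNode (P : Tree → Set) : Tree → Set where
  nil  : P nil → EveryNode P nil
  node : ∀ {c l k r} → P (node c l k r) →
         EveryNode P l → EveryNode P r → EveryNode P (node c l k r)

-- Strict inequalities: the keys of a tree are distinct.
Ordered : Tree → Set
Ordered nil            = ⊤
Ordered (node _ l k r) = All (_< k) (keys l) × All (k <_) (keys r)

RedRule : Tree → Set
RedRule nil                = ⊤
RedRule (node red l _ r)   = colour l ≡ black × colour r ≡ black
RedRule (node black _ _ _) = ⊤

-- Excluding the starting node from every count does not affect whether the
-- counts agree.
Balanced : Tree → Set
Balanced t = All (λ b → All (b ≡_) (blackCounts t)) (blackCounts t)

record RedBlack (t : Tree) : Set where
  constructor redBlack
  field
    bst      : EveryNode Ordered t
    redRule  : EveryNode RedRule t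
    balanced : EveryNode Balanced t

HasBlackHeight : Tree → ℤ → Set
HasBlackHeight t j = All (λ b → + b ≡ j) (blackCounts t)

record Admissible (i : ℕ) (j : ℤ) (c : Colour) (t : Tree) : Set where
  constructor admissible
  field
    isRedBlack  : RedBlack t
    onKeys      : size t ≡ i
    blackHeight : HasBlackHeight t j
    rootColour  : colour t ≡ c

-- Values live in ℕ ₋, with ⊥₋ as -∞.

infixl 6 _+₋_ _⊔₋_

_+₋_ : ℕ ₋ → ℕ ₋ → ℕ ₋
⊥₋    +₋ _     = ⊥₋
[ _ ] +₋ ⊥₋    = ⊥₋
[ x ] +₋ [ y ] = [ x + y ]

_⊔₋_ : ℕ ₋ → ℕ ₋ → ℕ ₋
⊥₋    ⊔₋ y     = y
[ x ] ⊔₋ ⊥₋    = [ x ]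
[ x ] ⊔₋ [ y ] = [ x ⊔ y ]

data IsLargestRedCount (i : ℕ) (j : ℤ) (c : Colour) : ℕ ₋ → Set where
  none     : (∀ t → ¬ Admissible i j c t) → IsLargestRedCount i j c ⊥₋
  attained : ∀ t → Admissible i j c t →
             (∀ s → Admissible i j c s → redCount s ≤ redCount t) →
             IsLargestRedCount i j c [ redCount t ]

-- The largest red count exists: keys can be renamed to 0, …, i - 1, which
-- leaves finitely many trees to search.

everyNode? : ∀ {P} → (∀ t → Dec (P t)) → ∀ t → Dec (EveryNode P t)
everyNode? P? nil = map′ nil (λ { (nil p) → p }) (P? nil)
everyNode? P? t@(node c l k r) =
  map′ (λ { (p , q , s) → node p q s }) (λ { (node p q s) → p , q , s })
       (P? t ×-dec everyNode? P? l ×-dec everyNode? P? r)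

_≟ᶜ_ : (c d : Colour) → Dec (c ≡ d)
red   ≟ᶜ red   = yes refl
red   ≟ᶜ black = no λ ()
black ≟ᶜ red   = no λ ()
black ≟ᶜ black = yes refl

ordered? : ∀ t → Dec (Ordered t)
ordered? nil            = yes tt
ordered? (node _ l k r) = all? (_<? k) (keys l) ×-dec all? (k <?_) (keys r)

redRule? : ∀ t → Dec (RedRule t)
redRule? nil                = yes tt
redRule? (node red l _ r)   = (colour l ≟ᶜ black) ×-dec (colour r ≟ᶜ black)
redRule? (node black _ _ _) = yes tt

balanced? : ∀ t → Dec (Balanced t)
balanced? t = all? (λ b → all? (b ≟_) (blackCounts t)) (blackCounts t)

redBlack? : ∀ t → Dec (RedBlack t)
redBlack? t =
  map′ (λ { (p , q , s) → redBlack p q s }) (λ { (redBlack p q s) → p , q , s })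
       (everyNode? ordered? t ×-dec everyNode? redRule? t ×-dec everyNode? balanced? t)

admissible? : ∀ i j c t → Dec (Admissible i j c t)
admissible? i j c t =
  map′ (λ { (p , q , s , u) → admissible p q s u })
       (λ { (admissible p q s u) → p , q , s , u })
       (redBlack? t ×-dec (size t ≟ i) ×-dec
        all? (λ b → + b ℤ.≟ j) (blackCounts t) ×-dec (colour t ≟ᶜ c))

-- Renames the keys of t, in order, to k, k + 1, …, k + size t - 1.
relabel : ℕ → Tree → Tree
relabel k nil            = nil
relabel k (node c l _ r) =
  node c (relabel k l) (k + size l) (relabel (suc (k + size l)) r)

colour-relabel : ∀ k t → colour (relabel k t) ≡ colour t
colour-relabel k nil            = refl
colour-relabel k (node _ _ _ _) = refl

size-relabel : ∀ k t → size (relabel k t) ≡ size t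
size-relabel k nil            = refl
size-relabel k (node _ l _ r) =
  cong suc (cong₂ _+_ (size-relabel k l) (size-relabel _ r))

redCount-relabel : ∀ k t → redCount (relabel k t) ≡ redCount t
redCount-relabel k nil                = refl
redCount-relabel k (node red   l _ r) =
  cong suc (cong₂ _+_ (redCount-relabel k l) (redCount-relabel _ r))
redCount-relabel k (node black l _ r) =
  cong₂ _+_ (redCount-relabel k l) (redCount-relabel _ r)

blackCounts-relabel : ∀ k t → blackCounts (relabel k t) ≡ blackCounts t
blackCounts-relabel k nil            = refl
blackCounts-relabel k (node _ l _ r) =
  cong₂ _++_
    (cong₂ (λ c → map (λ b → isBlack c + b)) (colour-relabel k l) (blackCounts-relabel k l))
    (cong₂ (λ c → map (λ b → isBlack c + b)) (colour-relabel _ r) (blackCounts-relabel _ r))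

keys-relabel : ∀ k t → All (λ x → k ≤ x × x < k + size t) (keys (relabel k t))
keys-relabel k nil            = []
keys-relabel k (node _ l _ r) = All.++⁺
  (All.map (λ { (p , q) → p , <-≤-trans q (+-monoʳ-≤ k (≤-trans (m≤m+n _ (size r)) (<⇒≤ (n<1+n _)))) })
           (keys-relabel k l))
  ((m≤m+n k _ , +-monoʳ-< k (s≤s (m≤m+n _ _))) ∷
   All.map (λ { (p , q) → ≤-trans (m≤m+n k _) (<⇒≤ p) , <-≤-trans q (≤-reflexive shift) })
           (keys-relabel _ r))
  where
  shift : suc (k + size l) + size r ≡ k + suc (size l + size r)
  shift = trans (cong suc (+-assoc k (size l) (size r))) (sym (+-suc k _))

bst-relabel : ∀ k t → EveryNode Ordered (relabel k t)
bst-relabel k nil            = nil tt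
bst-relabel k (node _ l _ r) =
  node (All.map proj₂ (keys-relabel k l) , All.map proj₁ (keys-relabel _ r))
       (bst-relabel k l) (bst-relabel _ r)

redRule-relabel : ∀ k {t} → EveryNode RedRule t → EveryNode RedRule (relabel k t)
redRule-relabel k (nil p) = nil p
redRule-relabel k (node {red} {l} {_} {r} (p , q) u v) =
  node (trans (colour-relabel k l) p , trans (colour-relabel _ r) q)
       (redRule-relabel k u) (redRule-relabel _ v)
redRule-relabel k (node {black} p u v) =
  node p (redRule-relabel k u) (redRule-relabel _ v)

balanced-relabel : ∀ k {t} → EveryNode Balanced t → EveryNode Balanced (relabel k t)
balanced-relabel k (nil p) = nil p
balanced-relabel k (node {c} {l} {x} {r} p u v) =
  node (subst (λ bs → All (λ b → All (b ≡_) bs) bs)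
              (sym (blackCounts-relabel k (node c l x r))) p)
       (balanced-relabel k u) (balanced-relabel _ v)

admissible-relabel : ∀ {i j c} k t → Admissible i j c t → Admissible i j c (relabel k t)
admissible-relabel {j = j} k t (admissible (redBlack _ p q) s h e) = admissible
  (redBlack (bst-relabel k t) (redRule-relabel k p) (balanced-relabel k q))
  (trans (size-relabel k t) s)
  (subst (All (λ b → + b ≡ j)) (sym (blackCounts-relabel k t)) h)
  (trans (colour-relabel k t) e)

-- All trees of height at most d with keys below n.
trees : ℕ → ℕ → List Tree
trees n zero    = nil ∷ []
trees n (suc d) = nil ∷
  cartesianProductWith (λ { (c , k) (l , r) → node c l k r })
    (cartesianProduct (red ∷ black ∷ []) (upTo n))
    (cartesianProduct (trees n d) (trees n d))

∈-colours : ∀ c → c ∈ red ∷ black ∷ []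
∈-colours red   = here refl
∈-colours black = there (here refl)

∈-trees : ∀ {n} d t → size t ≤ d → All (_< n) (keys t) → t ∈ trees n d
∈-trees zero    nil            _       _ = here refl
∈-trees (suc d) nil            _       _ = here refl
∈-trees (suc d) (node c l k r) (s≤s p) q with All.++⁻ (keys l) q
... | ql , qk ∷ qr = there (∈-cartesianProductWith⁺ _
  (∈-cartesianProduct⁺ (∈-colours c) (∈-upTo⁺ qk))
  (∈-cartesianProduct⁺ (∈-trees d l (≤-trans (m≤m+n _ _) p) ql)
                       (∈-trees d r (≤-trans (m≤n+m _ _) p) qr)))

candidates : ℕ → ℤ → Colour → List Tree
candidates i j c = filter (admissible? i j c) (trees i i)

∈-candidates : ∀ {i j c} t → Admissible i j c t → relabel 0 t ∈ candidates i j c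
∈-candidates {i} {j} {c} t adm@(admissible _ refl _ _) =
  ∈-filter⁺ (admissible? i j c)
    (∈-trees (size t) (relabel 0 t) (≤-reflexive (size-relabel 0 t))
             (All.map proj₂ (keys-relabel 0 t)))
    (admissible-relabel 0 t adm)

opaque
  largestRedCount : ∀ i j c → ∃ (IsLargestRedCount i j c)
  largestRedCount i j c = search (candidates i j c) ∈-candidates
      (All.tabulate (λ p → proj₂ (∈-filter⁻ (admissible? i j c) {xs = trees i i} p)))
    where
    search : ∀ ts → (∀ t → Admissible i j c t → relabel 0 t ∈ ts) →
             All (Admissible i j c) ts → ∃ (IsLargestRedCount i j c)
    search []       complete _ = ⊥₋ , none λ t adm → case complete t adm of λ ()
    search (t ∷ ts) complete (p ∷ ps) =
      [ redCount best ] , attained best (argmax-all redCount p ps) λ s adm →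
        subst (_≤ redCount best) (redCount-relabel 0 s) (All.lookup best-max (complete s adm))
      where
      best : Tree
      best = argmax redCount t ts

      best-max : All (λ s → redCount s ≤ redCount best) (t ∷ ts)
      best-max = f[⊥]≤f[argmax] {f = redCount} t ts ∷ f[xs]≤f[argmax] {f = redCount} t ts

-- The root colours 0 and 1 of a(i, j, 0) and a(i, j, 1) are red and black.
a : ℕ → ℤ → Colour → ℕ ₋
a i j c = proj₁ (largestRedCount i j c)

a-isLargest : ∀ i j c → IsLargestRedCount i j c (a i j c)
a-isLargest i j c = proj₂ (largestRedCount i j c)

-- The maximum of f t over the integers 0 ≤ t ≤ i / 2.
max-upTo-half : ℕ → (ℕ → ℕ ₋) → ℕ ₋
max-upTo-half i f = foldr _⊔₋_ ⊥₋ (map f (upTo (suc ⌊ i /2⌋)))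

-- For i ≥ 1 and t ≤ i / 2 we have t + 1 ≤ i, so ∸ does not truncate.
α₁ α₂ α₃ : ℕ → ℤ → ℕ ₋
α₁ i j = max-upTo-half i λ t → a t (j ℤ.- 1ℤ) black +₋ a (i ∸ t ∸ 1) (j ℤ.- 1ℤ) black
α₂ i j = max-upTo-half i λ t → a t j red +₋ a (i ∸ t ∸ 1) j red
α₃ i j = max-upTo-half i λ t → a t (j ℤ.- 1ℤ) black +₋ a (i ∸ t ∸ 1) j red

-- Base-2 logarithm bounds, for i ≥ 1, with the logarithm removed by
-- exponentiating: ½ log i ≤ j iff i ≤ 2^(2j), and j ≤ 2 log i iff 2^j ≤ i².
-- When j is negative the power of 2 is moved to the other side.
½log_≤_ : ℕ → ℤ → Set
½log i ≤ (+ k)    = i ≤ 2 ^ (2 * k)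
½log i ≤ -[1+ k ] = i * 2 ^ (2 * suc k) ≤ 1

_≤2log_ : ℤ → ℕ → Set
(+ k)    ≤2log i = 2 ^ k ≤ i ^ 2
-[1+ k ] ≤2log i = 1 ≤ i ^ 2 * 2 ^ suc k

{-# OPTIONS --safe #-}
-- Splitting a tree at its root gives the recursion at once, except that the
-- sums for i allow only t ≤ i / 2 keys in the first subtree. If both children
-- have the same colour they can be swapped. If they differ and the black child
-- B has more keys than the red child R, whose children are X and Y, then the
-- root with children Y (black) and a new red node over B and X has the same
-- size, black-height and number of red nodes, and Y has fewer keys than B.
module Submission where

open import Algebra using (AbelianGroup)
open import Defs
open import Data.Integer as ℤ using (ℤ; +_; 1ℤ)
import Data.Integer.Properties as ℤ
open import Algebra.Properties.Group (AbelianGroup.group ℤ.+-0-abelianGroup) using (//-rightDividesˡ)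
open import Data.List.Base using (foldr; map; upTo)
open import Data.List.Membership.Propositional using (_∈_)
open import Data.List.Membership.Propositional.Properties
  using (∈-map⁺; ∈-map⁻; ∈-upTo⁺; ∈-upTo⁻; foldr-selective)
open import Data.List.Relation.Unary.All as All using (All)
import Data.List.Relation.Unary.All.Properties as All
open import Data.List.Relation.Unary.Any using (here; there)
open import Data.Nat using (ℕ; suc; _+_; _∸_; _≤_; s≤s; ⌊_/2⌋)
open import Data.Nat.Properties
open import Data.Nat.Tactic.RingSolver using (solve-∀)
open import Data.Product using (_×_; _,_; ∃)
open import Data.Sum using (_⊎_; inj₁; inj₂)
open import Data.Unit using (⊤; tt)
open import Relation.Binary.Construct.Add.Infimum.NonStrict _≤_
  using (_≤₋_; ⊥₋≤_; [_]; ≤₋-trans; ≤₋-reflexive-≡; ≤₋-antisym-≡)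
open import Relation.Binary.PropositionalEquality
  using (_≡_; refl; sym; trans; cong; subst; subst₂)
open import Relation.Nullary.Construct.Add.Infimum using (_₋; ⊥₋; [_])

-- Arithmetic and order with -∞ adjoined.

+₋-identityˡ : ∀ x → [ 0 ] +₋ x ≡ x
+₋-identityˡ ⊥₋    = refl
+₋-identityˡ [ _ ] = refl

⊔₋-sel : ∀ x y → x ⊔₋ y ≡ x ⊎ x ⊔₋ y ≡ y
⊔₋-sel ⊥₋    y     = inj₂ refl
⊔₋-sel [ x ] ⊥₋    = inj₁ refl
⊔₋-sel [ x ] [ y ] with ⊔-sel x y
... | inj₁ eq = inj₁ (cong [_] eq)
... | inj₂ eq = inj₂ (cong [_] eq)

≤₋-refl : ∀ {x} → x ≤₋ x
≤₋-refl = ≤₋-reflexive-≡ ≤-reflexive refl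

x≤₋x⊔₋y : ∀ x y → x ≤₋ x ⊔₋ y
x≤₋x⊔₋y ⊥₋    y     = ⊥₋≤ y
x≤₋x⊔₋y [ x ] ⊥₋    = ≤₋-refl
x≤₋x⊔₋y [ x ] [ y ] = [ m≤m⊔n x y ]

y≤₋x⊔₋y : ∀ x y → y ≤₋ x ⊔₋ y
y≤₋x⊔₋y ⊥₋    y     = ≤₋-refl
y≤₋x⊔₋y [ x ] ⊥₋    = ⊥₋≤ _
y≤₋x⊔₋y [ x ] [ y ] = [ m≤n⊔m x y ]

⊔₋-lub : ∀ {x y z} → x ≤₋ z → y ≤₋ z → x ⊔₋ y ≤₋ z
⊔₋-lub {x} {y} {z} p q with ⊔₋-sel x y
... | inj₁ eq = subst (_≤₋ z) (sym eq) p
... | inj₂ eq = subst (_≤₋ z) (sym eq) q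

∈⇒≤₋foldr-⊔₋ : ∀ {x xs} → x ∈ xs → x ≤₋ foldr _⊔₋_ ⊥₋ xs
∈⇒≤₋foldr-⊔₋ (here refl) = x≤₋x⊔₋y _ _
∈⇒≤₋foldr-⊔₋ (there p)   = ≤₋-trans ≤-trans (∈⇒≤₋foldr-⊔₋ p) (y≤₋x⊔₋y _ _)

f[t]≤₋max-upTo-half : ∀ {i t} (f : ℕ → ℕ ₋) → t ≤ ⌊ i /2⌋ → f t ≤₋ max-upTo-half i f
f[t]≤₋max-upTo-half f p = ∈⇒≤₋foldr-⊔₋ (∈-map⁺ f (∈-upTo⁺ (s≤s p)))

-- Since `_⊔₋_` always returns one of its arguments, the fold is either its starting value `⊥₋` or
-- one of the listed terms.
max-upTo-half-elim : ∀ (P : ℕ ₋ → Set) i f → P ⊥₋ → (∀ t → t ≤ ⌊ i /2⌋ → P (f t)) →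
                     P (max-upTo-half i f)
max-upTo-half-elim P i f p⊥ pf
  with foldr-selective ⊔₋-sel ⊥₋ (map f (upTo (suc ⌊ i /2⌋)))
... | inj₁ eq = subst P (sym eq) p⊥
... | inj₂ m∈ with ∈-map⁻ f m∈
...   | t , t∈ , eq with ∈-upTo⁻ t∈
...     | s≤s t≤ = subst P (sym eq) (pf t t≤)

-- Largest red counts as least upper bounds.

largest-upper : ∀ {i j c v t} → IsLargestRedCount i j c v → Admissible i j c t →
                [ redCount t ] ≤₋ v
largest-upper (none empty)         adm with () ← empty _ adm
largest-upper (attained _ _ upper) adm = [ upper _ adm ]

-- A sum with a missing tree is -∞; otherwise both values are red counts of actual trees. The values
-- are variables, so that matching on the evidence determines them.
largest-sum-least : ∀ {k i j c i′ j′ c′ v v′ w} →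
  IsLargestRedCount i j c v → IsLargestRedCount i′ j′ c′ v′ →
  (∀ {s t} → Admissible i j c s → Admissible i′ j′ c′ t →
             [ k + (redCount s + redCount t) ] ≤₋ w) →
  [ k ] +₋ (v +₋ v′) ≤₋ w
largest-sum-least (none _)           _                    least = ⊥₋≤ _
largest-sum-least (attained _ _ _)   (none _)             least = ⊥₋≤ _
largest-sum-least (attained _ adm _) (attained _ adm′ _)  least = least adm adm′

redCount≤₋a : ∀ {i j c t} → Admissible i j c t → [ redCount t ] ≤₋ a i j c
redCount≤₋a = largest-upper (a-isLargest _ _ _)

a-least : ∀ {i j c w} → (∀ t → Admissible i j c t → [ redCount t ] ≤₋ w) → a i j c ≤₋ w
a-least {i} {j} {c} least = go (a-isLargest i j c)
  where
  go : ∀ {v} → IsLargestRedCount i j c v → v ≤₋ _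
  go (none _)           = ⊥₋≤ _
  go (attained t adm _) = least t adm

-- Joining and splitting trees at the root.

isRed : Colour → ℕ
isRed red   = 1
isRed black = 0

-- The black-height of a child of colour c under a node of black-height j.
childHeight : ℤ → Colour → ℤ
childHeight j red   = j
childHeight j black = j ℤ.- 1ℤ

childHeight⇒ : ∀ {j} c {b} → + (isBlack c + b) ≡ j → + b ≡ childHeight j c
childHeight⇒ red   eq   = eq
-- Here `j` becomes `+ suc b`, from which subtracting one computes to `+ b`.
childHeight⇒ black refl = refl

childHeight⇐ : ∀ {j} c {b} → + b ≡ childHeight j c → + (isBlack c + b) ≡ j
childHeight⇐     red   eq = eq
childHeight⇐ {j} black eq =
  trans (cong (ℤ._+_ 1ℤ) eq) (trans (ℤ.+-comm 1ℤ (j ℤ.- 1ℤ)) (//-rightDividesˡ 1ℤ j))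

-- Stated through colours alone, so that it makes sense before any subtrees are chosen.
RedBlack-children : Colour → Colour → Colour → Set
RedBlack-children red   c₁ c₂ = c₁ ≡ black × c₂ ≡ black
RedBlack-children black _  _  = ⊤

redCount-node : ∀ c l k r →
  redCount (node c l k r) ≡ isRed c + (redCount l + redCount r)
redCount-node red   l k r = refl
redCount-node black l k r = refl

hasBlackHeight⇒balanced : ∀ {j} t → HasBlackHeight t j → Balanced t
hasBlackHeight⇒balanced t h =
  All.map (λ p → All.map (λ q → ℤ.+-injective (trans p (sym q))) h) h

-- The keys of `l` and `r` may overlap, so the root gets the placeholder key 0 and the whole tree is
-- then relabelled in order. This makes it a search tree and keeps its shape and colours.
join : ∀ {i j i′ c₁ c₂ l r} c → RedBlack-children c c₁ c₂ →
       Admissible i (childHeight j c₁) c₁ l → Admissible i′ (childHeight j c₂) c₂ r →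
       ∃ λ t → Admissible (suc (i + i′)) j c t ×
               redCount t ≡ isRed c + (redCount l + redCount r)
join {j = j} {l = l} {r} c rule
     (admissible (redBlack _ lr lb) refl lh refl) (admissible (redBlack _ rr rb) refl rh refl) =
  relabel 0 t ,
  joined ,
  trans (redCount-relabel 0 t) (redCount-node c l 0 r)
  where
  t : Tree
  t = node c l 0 r

  height : HasBlackHeight t j
  height = All.++⁺ (All.map⁺ (All.map (childHeight⇐ (colour l)) lh))
                   (All.map⁺ (All.map (childHeight⇐ (colour r)) rh))

  redRule : ∀ c → RedBlack-children c (colour l) (colour r) → RedRule (node c l 0 r)
  redRule red   p = p
  redRule black _ = tt

  joined : Admissible _ j c (relabel 0 t)
  joined = admissible
    (redBlack (bst-relabel 0 t)
              (redRule-relabel 0 (node (redRule c rule) lr rr))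
              (balanced-relabel 0 {t} (node (hasBlackHeight⇒balanced t height) lb rb)))
    (size-relabel 0 t)
    (subst (All (λ b → + b ≡ j)) (sym (blackCounts-relabel 0 t)) height)
    refl

split : ∀ {i j c d l k r} → Admissible i j c (node d l k r) →
        RedBlack-children c (colour l) (colour r) ×
        Admissible (size l) (childHeight j (colour l)) (colour l) l ×
        Admissible (size r) (childHeight j (colour r)) (colour r) r
split {j = j} {c} {d} {l} {k} {r}
      (admissible (redBlack (node _ lo ro) (node rule lr rr) (node _ lb rb)) _ h refl)
  with All.++⁻ (map (λ b → isBlack (colour l) + b) (blackCounts l)) h
... | lh , rh =
  children d rule ,
  admissible (redBlack lo lr lb) refl (All.map (childHeight⇒ (colour l)) (All.map⁻ lh)) refl ,
  admissible (redBlack ro rr rb) refl (All.map (childHeight⇒ (colour r)) (All.map⁻ rh)) refl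
  where
  children : ∀ d → RedRule (node d l k r) → RedBlack-children d (colour l) (colour r)
  children red   p = p
  children black _ = tt

-- α₁, α₂ and α₃ are the instances black black, red red and black red.
α : Colour → Colour → ℕ → ℤ → ℕ ₋
α c₁ c₂ i j = max-upTo-half i λ t →
  a t (childHeight j c₁) c₁ +₋ a (i ∸ t ∸ 1) (childHeight j c₂) c₂

-- Lower bounds for `a`.

α≤₋a : ∀ {i j c₁ c₂} c → RedBlack-children c c₁ c₂ → 1 ≤ i →
       [ isRed c ] +₋ α c₁ c₂ i j ≤₋ a i j c
α≤₋a {suc m} {j} {c₁} {c₂} c rule (s≤s _) =
  max-upTo-half-elim (λ x → [ isRed c ] +₋ x ≤₋ a (suc m) j c) (suc m) _ (⊥₋≤ _) term
  where
  term : ∀ t → t ≤ ⌊ suc m /2⌋ →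
         [ isRed c ] +₋ (a t (childHeight j c₁) c₁ +₋ a (suc m ∸ t ∸ 1) (childHeight j c₂) c₂)
           ≤₋ a (suc m) j c
  term t t≤ = largest-sum-least (a-isLargest _ _ _) (a-isLargest _ _ _) joined
    where
    -- The subtractions do not truncate, because `t` is at most half of `suc m` and hence at most
    -- `m`.
    total : suc (t + (suc m ∸ t ∸ 1)) ≡ suc m
    total = cong suc (trans (cong (λ x → t + x)
      (trans (∸-+-assoc (suc m) t 1) (cong (suc m ∸_) (+-comm t 1))))
      (m+[n∸m]≡n (≤-trans t≤ (≤-pred (⌊n/2⌋<n m)))))

    joined : ∀ {l r} → Admissible t (childHeight j c₁) c₁ l →
             Admissible (suc m ∸ t ∸ 1) (childHeight j c₂) c₂ r →
             [ isRed c + (redCount l + redCount r) ] ≤₋ a (suc m) j c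
    joined p q with join c rule p q
    ... | _ , adm , count = subst₂ (λ x i → [ x ] ≤₋ a i j c) count total (redCount≤₋a adm)

-- Upper bounds for `a`.

-- The pair is counted by the term `t = s`, which is in range because the smaller subtree comes
-- first.
redCount≤₋α : ∀ {s u j c₁ c₂ l r} → s ≤ u →
  Admissible s (childHeight j c₁) c₁ l → Admissible u (childHeight j c₂) c₂ r →
  [ redCount l + redCount r ] ≤₋ α c₁ c₂ (suc (s + u)) j
redCount≤₋α {s} {u} {j} {c₁} {c₂} s≤u p q =
  ≤₋-trans ≤-trans
    (+₋-mono (redCount≤₋a p)
             (redCount≤₋a (subst (λ x → Admissible x _ _ _) (sym rest) q)))
    (f[t]≤₋max-upTo-half
      (λ t → a t (childHeight j c₁) c₁ +₋ a (suc (s + u) ∸ t ∸ 1) (childHeight j c₂) c₂) half)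
  where
  +₋-mono : ∀ {w x y z} → w ≤₋ x → y ≤₋ z → w +₋ y ≤₋ x +₋ z
  +₋-mono (⊥₋≤ _) _        = ⊥₋≤ _
  +₋-mono [ _ ]   (⊥₋≤ _)  = ⊥₋≤ _
  +₋-mono [ w≤x ] [ y≤z ]  = [ +-mono-≤ w≤x y≤z ]

  rest : suc (s + u) ∸ s ∸ 1 ≡ u
  rest = trans (∸-+-assoc (suc (s + u)) s 1)
           (trans (cong (suc (s + u) ∸_) (+-comm s 1)) (m+n∸m≡n s u))

  half : s ≤ ⌊ suc (s + u) /2⌋
  half = ≤-trans (≤-reflexive (n≡⌊n+n/2⌋ s))
                 (⌊n/2⌋-mono (m≤n⇒m≤1+n (+-monoʳ-≤ s s≤u)))

redCount≤₋α-sameColour : ∀ {s u j c l r} →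
  Admissible s (childHeight j c) c l → Admissible u (childHeight j c) c r →
  [ redCount l + redCount r ] ≤₋ α c c (suc (s + u)) j
redCount≤₋α-sameColour {s} {u} {j} {c} {l} {r} p q with ≤-total s u
... | inj₁ s≤u = redCount≤₋α s≤u p q
... | inj₂ u≤s = subst₂ (λ x i → [ x ] ≤₋ α c c (suc i) j)
                   (+-comm (redCount r) (redCount l)) (+-comm u s) (redCount≤₋α u≤s q p)

redCount≤₋α-black-red : ∀ {s u j l r} →
  Admissible s (childHeight j black) black l → Admissible u j red r →
  [ redCount l + redCount r ] ≤₋ α black red (suc (s + u)) j
redCount≤₋α-black-red {s} {u} {j} {l} {r} p q with ≤-total s u
... | inj₁ s≤u = redCount≤₋α s≤u p q
redCount≤₋α-black-red {r = nil}              _ (admissible _ _ _ ()) | inj₂ _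
redCount≤₋α-black-red {r = node black _ _ _} _ (admissible _ _ _ ()) | inj₂ _
redCount≤₋α-black-red {s} {_} {j} {l} {node red x k y} p q@(admissible _ refl _ _) | inj₂ u≤s =
  let (cx , cy) , px , py = split q
      -- Both `l` and `x` are black of black-height `j - 1`, so the new red node over them has
      -- black-height `j`, like the old red child.
      _ , p′ , count      = join red (refl , cx) p px
      py′                 = subst (λ c → Admissible (size y) (childHeight j c) c y) cy py
  in subst₂ (λ m i → [ m ] ≤₋ α black red (suc i) j)
       (trans (cong (λ m → redCount y + m) count)
              (rotate (redCount y) (redCount l) (redCount x)))
       (rotate (size y) s (size x))
       (redCount≤₋α y≤ py′ p′)
  where
  -- One identity serves red counts and sizes alike: the successor stands for the new red node on
  -- the left and for the old one on the right.
  rotate : ∀ y b x → y + suc (b + x) ≡ b + suc (x + y)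
  rotate = solve-∀

  -- `y` is part of the red child, which has at most `s` keys, so the rebuilt tree has its smaller
  -- subtree first.
  y≤ : size y ≤ suc (s + size x)
  y≤ = ≤-trans (m≤n+m (size y) (suc (size x))) (≤-trans u≤s (m≤n⇒m≤1+n (m≤m+n s (size x))))

-- A red root forces two black children, and the root itself supplies the summand 1.
a-red≤₋ : ∀ {i j} → 1 ≤ i → a i j red ≤₋ [ 1 ] +₋ α₁ i j
a-red≤₋ {suc _} {j} _ = a-least bound
  where
  bound : ∀ {i} t → Admissible (suc i) j red t → [ redCount t ] ≤₋ [ 1 ] +₋ α₁ (suc i) j
  bound nil (admissible _ () _ _)
  bound (node black _ _ _) (admissible _ _ _ ())
  bound (node red l k r) adm@(admissible _ refl _ _) with split adm
  ... | (cl , cr) , pl , pr =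
    suc-mono (redCount≤₋α-sameColour {j = j} (as-black cl pl) (as-black cr pr))
    where
    as-black : ∀ {i c t} → c ≡ black → Admissible i (childHeight j c) c t →
               Admissible i (childHeight j black) black t
    as-black refl p = p

    suc-mono : ∀ {m x} → [ m ] ≤₋ x → [ suc m ] ≤₋ [ 1 ] +₋ x
    suc-mono [ p ] = [ s≤s p ]

-- A black root adds no red node and allows all four pairs of child colours; the two mixed pairs
-- share `α₃`.
a-black≤₋ : ∀ {i j} → 1 ≤ i → a i j black ≤₋ α₁ i j ⊔₋ α₂ i j ⊔₋ α₃ i j
a-black≤₋ {suc _} {j} _ = a-least bound
  where
  via₁ : ∀ {w x y z} → w ≤₋ x → w ≤₋ x ⊔₋ y ⊔₋ z
  via₁ p = ≤₋-trans ≤-trans p (≤₋-trans ≤-trans (x≤₋x⊔₋y _ _) (x≤₋x⊔₋y _ _))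

  via₂ : ∀ {w y z} x → w ≤₋ y → w ≤₋ x ⊔₋ y ⊔₋ z
  via₂ x p = ≤₋-trans ≤-trans p (≤₋-trans ≤-trans (y≤₋x⊔₋y x _) (x≤₋x⊔₋y _ _))

  via₃ : ∀ {w z} x y → w ≤₋ z → w ≤₋ x ⊔₋ y ⊔₋ z
  via₃ x y p = ≤₋-trans ≤-trans p (y≤₋x⊔₋y (x ⊔₋ y) _)

  joined : ∀ c₁ c₂ {s u l r} →
    Admissible s (childHeight j c₁) c₁ l → Admissible u (childHeight j c₂) c₂ r →
    [ redCount l + redCount r ] ≤₋ α₁ (suc (s + u)) j ⊔₋ α₂ (suc (s + u)) j ⊔₋ α₃ (suc (s + u)) j
  joined black black p q = via₁ (redCount≤₋α-sameColour {j = j} p q)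
  joined red   red   {s} {u} p q = via₂ (α₁ (suc (s + u)) j) (redCount≤₋α-sameColour p q)
  joined black red   {s} {u} p q =
    via₃ (α₁ (suc (s + u)) j) (α₂ (suc (s + u)) j) (redCount≤₋α-black-red p q)
  -- Mirror image of the previous case: exchanging the children only commutes the sums.
  joined red   black {s} {u} {l} {r} p q =
    via₃ (α₁ (suc (s + u)) j) (α₂ (suc (s + u)) j)
      (subst₂ (λ m i → [ m ] ≤₋ α₃ (suc i) j)
        (+-comm (redCount r) (redCount l)) (+-comm u s) (redCount≤₋α-black-red q p))

  bound : ∀ {i} t → Admissible (suc i) j black t →
          [ redCount t ] ≤₋ α₁ (suc i) j ⊔₋ α₂ (suc i) j ⊔₋ α₃ (suc i) j
  bound nil (admissible _ () _ _)
  bound (node red _ _ _) (admissible _ _ _ ())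
  bound (node black l k r) adm@(admissible _ refl _ _) =
    let _ , pl , pr = split adm in joined (colour l) (colour r) pl pr

theorem1 : (n : ℕ) → 1 ≤ n →
    (i : ℕ) (j : ℤ) → 1 ≤ i → i ≤ n → ½log i ≤ j → j ≤2log i →
    (a i j red ≡ [ 1 ] +₋ α₁ i j) ×
    (a i j black ≡ α₁ i j ⊔₋ α₂ i j ⊔₋ α₃ i j)
theorem1 _ _ i j 1≤i _ _ _ =
  ≤₋-antisym-≡ ≤-antisym (a-red≤₋ 1≤i) (α≤₋a red (refl , refl) 1≤i) ,
  ≤₋-antisym-≡ ≤-antisym (a-black≤₋ 1≤i)
    (⊔₋-lub (⊔₋-lub (black-root {black} {black}) (black-root {red} {red})) (black-root {black} {red}))
  where
  black-root : ∀ {c₁ c₂} → α c₁ c₂ i j ≤₋ a i j black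
  -- For a black root the added `isRed` term is 0.
  black-root = subst (_≤₋ a i j black) (+₋-identityˡ _) (α≤₋a black tt 1≤i)
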